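{- Let $g(t)=\sum_{n\ge0}g_nt^n$ and $f(t)=\sum_{n\ge1}f_nt^n$ be formal power series with $g_0=1$ and $f_1\neq0$, and let $(d_{n,k})_{n,k\ge0}=(g,f)$ be the associated Riordan array, i.e. $d_{n,k}=[t^n]\,g(t)f(t)^k$. Fix integers $p\ge1$ and $r\ge0$, and let $\phi(t)$ be the compositional inverse of the series $t^p/f(t)^{p-1}$. Then the matrix $(\tilde d_{n,k})_{n,k\ge0}$ with $\tilde d_{n,k}=d_{pn+r,\,(p-1)n+r+k}$ is a Riordan array, namely $$(\tilde d_{n,k})_{n,k\ge0}=\left(\frac{t\,\phi'(t)\,g(\phi(t))\,f(\phi(t))^r}{\phi(t)^{r+1}},\ f(\phi(t))\right).$$ In particular, for $p=1,r=0$ it equals $(g,f)$, and for $p=2,r=0$ it is the horizontal half Riordan array $(d_{2n,n+k})_{n,k\ge0}$. Moreover, if $A(t)$ is the generating function of the $A$-sequence of $(g,f)$, then the generating function of the $A$-sequence of $(\tilde d_{n,k})$ is $(A(t))^p$.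
   Context: A Riordan array $(g,f)$, for $g(0)=1$, $f(0)=0$, $f'(0)\neq0$, is the infinite lower triangular matrix whose $(n,k)$ entry is $[t^n]g(t)f(t)^k$. The $A$-sequence of $(g,f)$ is the sequence $(a_n)_{n\ge0}$ whose generating function $A(t)=\sum_{n\ge0}a_nt^n$ is determined by $f(t)=t\,A(f(t))$; equivalently every entry satisfies $d_{n+1,k+1}=\sum_{j\ge0}a_jd_{n,k+j}$.
   Formalization: The new matrix is shown to have entries [t^n]G(t)f(φ(t))^k with the stated first component G, without requiring G(0)=1 in the definition of Riordan array; in fact G(0)=f_1^r, so the normalization fails in general for r≥1. -}

module Defs where

open import Level using (Level; _⊔_; suc)
open import Algebra.Bundles using (CommutativeRing)
open import Data.Nat as ℕ using (ℕ; zero; _∸_)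
open import Relation.Nullary using (¬_)

record Field (c ℓ : Level) : Set (suc (c ⊔ ℓ)) where
  field
    commutativeRing : CommutativeRing c ℓ
  open CommutativeRing commutativeRing public
  field
    1≉0 : ¬ (1# ≈ 0#)
    inverse : (x : Carrier) → ¬ (x ≈ 0#) → Carrier
    inverseʳ : (x : Carrier) (x≉0 : ¬ (x ≈ 0#)) → (x * inverse x x≉0) ≈ 1#

-- Formal power series over a field K, represented by their coefficient
-- sequences: a series a(t) = Σ a n t^n.
module FPS {c ℓ : Level} (K : Field c ℓ) where
  open Field K public using (_≈_; 0#; 1#)
  open Field K hiding (_≈_; 0#; 1#)

  Series : Set c
  Series = ℕ → Carrier

  infix 4 _≋_
  _≋_ : Series → Series → Set ℓ
  a ≋ b = ∀ n → a n ≈ b n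

  fromℕ : ℕ → Carrier
  fromℕ zero = 0#
  fromℕ (ℕ.suc n) = 1# + fromℕ n

  sumTo : ℕ → (ℕ → Carrier) → Carrier
  sumTo zero h = h 0
  sumTo (ℕ.suc n) h = sumTo n h + h (ℕ.suc n)

  one : Series
  one zero = 1#
  one (ℕ.suc n) = 0#

  X : Series
  X 1 = 1#
  X _ = 0#

  infixl 7 _⊛_
  _⊛_ : Series → Series → Series
  (a ⊛ b) n = sumTo n (λ i → a i * b (n ∸ i))

  infixr 8 _^ˢ_
  _^ˢ_ : Series → ℕ → Series
  a ^ˢ zero = one
  a ^ˢ ℕ.suc k = a ⊛ (a ^ˢ k)

  -- composition a(b(t)); the formula [t^n] a(b(t)) = Σ_{k≤n} a_k [t^n] b(t)^k
  -- is the composition of formal power series whenever b 0 = 0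
  -- (it is only ever used with such b).
  _∘ˢ_ : Series → Series → Series
  (a ∘ˢ b) n = sumTo n (λ k → a k * (b ^ˢ k) n)

  deriv : Series → Series
  deriv a n = fromℕ (ℕ.suc n) * a (ℕ.suc n)

  riordan : Series → Series → ℕ → ℕ → Carrier
  riordan G F n k = (G ⊛ (F ^ˢ k)) n

  IsASeqGF : Series → Series → Set ℓ
  IsASeqGF A f = f ≋ X ⊛ (A ∘ˢ f)

  IsCompInverse : Series → Series → Set ℓ
  IsCompInverse φ ψ = (φ 0 ≈ 0#) × ((ψ ∘ˢ φ) ≋ X) × ((φ ∘ˢ ψ) ≋ X)
    where open import Data.Product using (_×_)

  dtilde : (ℕ → ℕ → Carrier) → ℕ → ℕ → ℕ → ℕ → Carrier
  dtilde d p r n k = d (p ℕ.* n ℕ.+ r) ((p ∸ 1) ℕ.* n ℕ.+ r ℕ.+ k)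

{-# OPTIONS --safe #-}
-- Write f = t u(t) and U = u^(p-1), so that φ = s U(φ) and d̃(n,k) = [tⁿ] g u^r f^k Uⁿ. By Lagrange
-- inversion this is the coefficient of sⁿ in (g u^r f^k)(φ) φ′/U(φ), which is the claim.
--
-- The usual proof of Lagrange inversion divides by n, which fails in positive characteristic. Instead,
-- the functional Λ(H) = Σ sⁿ [tⁿ] H Uⁿ satisfies Λ(tH) = s Λ(UH), whose s-adically contracting
-- recursion forces Λ(QH) = Q(φ) Λ(H). The remaining constant Λ(1) is found by pairing U with the
-- geometric series 1/(t - φ), which gives Λ(1) = 1 + s U′(φ) Λ(1), that is Λ(1) = φ′/U(φ).
module Submission where

open import Defs
open import Level using (Level)
open import Algebra.Bundles using (CommutativeRing)
open import Data.Nat using (ℕ; zero; suc; _+_; _*_; _∸_; _≤_; z≤n; s≤s; _≤′_; ≤′-refl; ≤′-step)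
import Data.Nat.Properties as ℕₚ
open import Data.Product using (_×_; _,_; proj₁; proj₂)
open import Relation.Nullary using (¬_)
import Relation.Binary.PropositionalEquality as ≡
open ≡ using (_≡_)

-- The commutative ring of formal power series over a field.

module PowerSeries {c ℓ : Level} (K : Field c ℓ) where
  open FPS K public
  open Field K public
    using (Carrier; setoid; refl; sym; trans; +-cong; +-congˡ; +-congʳ; *-cong; *-congˡ; *-congʳ;
           +-assoc; +-comm; +-identityˡ; +-identityʳ; *-assoc; *-comm; *-identityˡ; *-identityʳ;
           zeroˡ; distribˡ; distribʳ)
    renaming (_+_ to _+ᴷ_; _*_ to _*ᴷ_; -_ to -ᴷ_)
  open Field K using (-‿cong; -‿inverseˡ; -‿inverseʳ; commutativeRing)
  open import Relation.Binary.Reasoning.Setoid setoid public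
  open import Algebra.Solver.Ring.NaturalCoefficients.Default
    (CommutativeRing.commutativeSemiring commutativeRing)
    using (solve; _:=_; _:+_; _:*_)

  sumTo-cong : ∀ n {a b : Series} → (∀ i → i ≤ n → a i ≈ b i) → sumTo n a ≈ sumTo n b
  sumTo-cong zero    e = e 0 z≤n
  sumTo-cong (suc n) e = +-cong (sumTo-cong n λ i i≤n → e i (ℕₚ.m≤n⇒m≤1+n i≤n)) (e (suc n) ℕₚ.≤-refl)

  sumTo-suc : ∀ n (a : Series) → sumTo (suc n) a ≈ a 0 +ᴷ sumTo n (λ i → a (suc i))
  sumTo-suc zero    a = refl
  sumTo-suc (suc n) a = trans (+-congʳ (sumTo-suc n a)) (+-assoc _ _ _)

  sumTo-*ˡ : ∀ n x (a : Series) → sumTo n (λ i → x *ᴷ a i) ≈ x *ᴷ sumTo n a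
  sumTo-*ˡ zero    x a = refl
  sumTo-*ˡ (suc n) x a = trans (+-congʳ (sumTo-*ˡ n x a)) (sym (distribˡ x _ _))

  sumTo-+ : ∀ n (a b : Series) → sumTo n (λ i → a i +ᴷ b i) ≈ sumTo n a +ᴷ sumTo n b
  sumTo-+ zero    a b = refl
  sumTo-+ (suc n) a b = trans (+-congʳ (sumTo-+ n a b))
    (solve 4 (λ w x y z → (w :+ x) :+ (y :+ z) := (w :+ y) :+ (x :+ z)) refl _ _ _ _)

  infixl 6 _⊕_
  _⊕_ : Series → Series → Series
  (a ⊕ b) n = a n +ᴷ b n

  ⊖_ : Series → Series
  (⊖ a) n = -ᴷ a n

  0ˢ : Series
  0ˢ n = 0#

  tail : Series → Series
  tail a n = a (suc n)

  const : Carrier → Series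
  const x zero    = x
  const x (suc n) = 0#

  scale : Carrier → Series → Series
  scale x a n = x *ᴷ a n

  -- Since `suc n ∸ suc i` reduces to `n ∸ i`, what remains after the term of index 0 is again a
  -- Cauchy product. The ring laws are proved from this recursion by induction on the degree.
  ⊛-suc : ∀ a b n → (a ⊛ b) (suc n) ≈ a 0 *ᴷ b (suc n) +ᴷ (tail a ⊛ b) n
  ⊛-suc a b n = sumTo-suc n (λ i → a i *ᴷ b (suc n ∸ i))

  -- Coefficient `n` of a product sees only coefficients up to `n`; the truncation and contraction
  -- arguments below depend on this bounded form.
  ⊛-cong-≤ : ∀ n {a a′ b b′ : Series} → (∀ i → i ≤ n → a i ≈ a′ i) → (∀ i → i ≤ n → b i ≈ b′ i) →
             (a ⊛ b) n ≈ (a′ ⊛ b′) n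
  ⊛-cong-≤ n e e′ = sumTo-cong n λ i i≤n → *-cong (e i i≤n) (e′ (n ∸ i) (ℕₚ.m∸n≤m n i))

  ⊛-cong : ∀ {a a′ b b′} → a ≋ a′ → b ≋ b′ → a ⊛ b ≋ a′ ⊛ b′
  ⊛-cong e e′ n = ⊛-cong-≤ n (λ i _ → e i) (λ i _ → e′ i)

  -- Peeling the leading term off each factor in turn leaves the product of the two tails two
  -- degrees lower, hence the separate base case in degree 1.
  ⊛-comm : ∀ a b → a ⊛ b ≋ b ⊛ a
  ⊛-comm a b zero          = *-comm _ _
  ⊛-comm a b (suc zero)    = solve 4 (λ w x y z → w :* x :+ y :* z := z :* y :+ x :* w) refl _ _ _ _
  ⊛-comm a b (suc (suc n)) = begin
    (a ⊛ b) (suc (suc n))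
      ≈⟨ ⊛-suc a b (suc n) ⟩
    a 0 *ᴷ b (suc (suc n)) +ᴷ (tail a ⊛ b) (suc n)
      ≈⟨ +-congˡ (⊛-comm (tail a) b (suc n)) ⟩
    a 0 *ᴷ b (suc (suc n)) +ᴷ (b ⊛ tail a) (suc n)
      ≈⟨ +-congˡ (⊛-suc b (tail a) n) ⟩
    a 0 *ᴷ b (suc (suc n)) +ᴷ (b 0 *ᴷ a (suc (suc n)) +ᴷ (tail b ⊛ tail a) n)
      ≈⟨ +-congˡ (+-congˡ (⊛-comm (tail b) (tail a) n)) ⟩
    a 0 *ᴷ b (suc (suc n)) +ᴷ (b 0 *ᴷ a (suc (suc n)) +ᴷ (tail a ⊛ tail b) n)
      ≈⟨ solve 3 (λ x y z → x :+ (y :+ z) := y :+ (x :+ z)) refl _ _ _ ⟩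
    b 0 *ᴷ a (suc (suc n)) +ᴷ (a 0 *ᴷ b (suc (suc n)) +ᴷ (tail a ⊛ tail b) n)
      ≈⟨ +-congˡ (⊛-suc a (tail b) n) ⟨
    b 0 *ᴷ a (suc (suc n)) +ᴷ (a ⊛ tail b) (suc n)
      ≈⟨ +-congˡ (⊛-comm a (tail b) (suc n)) ⟩
    b 0 *ᴷ a (suc (suc n)) +ᴷ (tail b ⊛ a) (suc n)
      ≈⟨ ⊛-suc b a (suc n) ⟨
    (b ⊛ a) (suc (suc n)) ∎

  ⊛-distribʳ : ∀ a b d → (b ⊕ d) ⊛ a ≋ (b ⊛ a) ⊕ (d ⊛ a)
  ⊛-distribʳ a b d n =
    trans (sumTo-cong n λ i _ → distribʳ _ _ _)
          (sumTo-+ n (λ i → b i *ᴷ a (n ∸ i)) (λ i → d i *ᴷ a (n ∸ i)))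

  ⊛-distribˡ : ∀ a b d → a ⊛ (b ⊕ d) ≋ (a ⊛ b) ⊕ (a ⊛ d)
  ⊛-distribˡ a b d n =
    trans (sumTo-cong n λ i _ → distribˡ _ _ _)
          (sumTo-+ n (λ i → a i *ᴷ b (n ∸ i)) (λ i → a i *ᴷ d (n ∸ i)))

  scale-⊛ : ∀ x a b → scale x a ⊛ b ≋ scale x (a ⊛ b)
  scale-⊛ x a b n = trans (sumTo-cong n λ i _ → *-assoc _ _ _) (sumTo-*ˡ n x λ i → a i *ᴷ b (n ∸ i))

  ⊛-assoc : ∀ a b d → (a ⊛ b) ⊛ d ≋ a ⊛ (b ⊛ d)
  ⊛-assoc a b d zero    = *-assoc _ _ _
  ⊛-assoc a b d (suc n) = begin
    ((a ⊛ b) ⊛ d) (suc n)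
      ≈⟨ ⊛-suc (a ⊛ b) d n ⟩
    (a 0 *ᴷ b 0) *ᴷ d (suc n) +ᴷ (tail (a ⊛ b) ⊛ d) n
      -- Here `⊛-suc a b` is read as an equation of series for `tail (a ⊛ b)`.
      ≈⟨ +-congˡ (⊛-cong {b = d} (⊛-suc a b) (λ _ → refl) n) ⟩
    (a 0 *ᴷ b 0) *ᴷ d (suc n) +ᴷ ((scale (a 0) (tail b) ⊕ tail a ⊛ b) ⊛ d) n
      ≈⟨ +-congˡ (⊛-distribʳ d (scale (a 0) (tail b)) (tail a ⊛ b) n) ⟩
    (a 0 *ᴷ b 0) *ᴷ d (suc n) +ᴷ ((scale (a 0) (tail b) ⊛ d) n +ᴷ ((tail a ⊛ b) ⊛ d) n)
      ≈⟨ +-congˡ (+-cong (scale-⊛ (a 0) (tail b) d n) (⊛-assoc (tail a) b d n)) ⟩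
    (a 0 *ᴷ b 0) *ᴷ d (suc n) +ᴷ (a 0 *ᴷ (tail b ⊛ d) n +ᴷ (tail a ⊛ (b ⊛ d)) n)
      ≈⟨ solve 5 (λ x y z v w → (x :* y) :* z :+ (x :* v :+ w) := x :* (y :* z :+ v) :+ w) refl _ _ _ _ _ ⟩
    a 0 *ᴷ (b 0 *ᴷ d (suc n) +ᴷ (tail b ⊛ d) n) +ᴷ (tail a ⊛ (b ⊛ d)) n
      ≈⟨ +-congʳ (*-congˡ (⊛-suc b d n)) ⟨
    a 0 *ᴷ (b ⊛ d) (suc n) +ᴷ (tail a ⊛ (b ⊛ d)) n
      ≈⟨ ⊛-suc a (b ⊛ d) n ⟨
    (a ⊛ (b ⊛ d)) (suc n) ∎

  0ˢ-⊛ : ∀ a → 0ˢ ⊛ a ≋ 0ˢ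
  0ˢ-⊛ a zero    = zeroˡ _
  0ˢ-⊛ a (suc n) = trans (⊛-suc 0ˢ a n) (trans (+-cong (zeroˡ _) (0ˢ-⊛ a n)) (+-identityˡ _))

  const-⊛ : ∀ x a → const x ⊛ a ≋ scale x a
  const-⊛ x a zero    = refl
  const-⊛ x a (suc n) = trans (⊛-suc (const x) a n) (trans (+-congˡ (0ˢ-⊛ a n)) (+-identityʳ _))

  one≋const : one ≋ const 1#
  one≋const zero    = refl
  one≋const (suc n) = refl

  ⊛-identityˡ : ∀ a → one ⊛ a ≋ a
  ⊛-identityˡ a n = trans (⊛-cong {b = a} one≋const (λ _ → refl) n) (trans (const-⊛ 1# a n) (*-identityˡ _))

  seriesRing : CommutativeRing c ℓ
  seriesRing = record
    { Carrier = Series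
    ; _≈_ = _≋_
    ; _+_ = _⊕_
    ; _*_ = _⊛_
    ; -_  = ⊖_
    ; 0#  = 0ˢ
    ; 1#  = one
    ; isCommutativeRing = record
      { isRing = record
        { +-isAbelianGroup = record
          { isGroup = record
            { isMonoid = record
              { isSemigroup = record
                { isMagma = record
                  { isEquivalence = record
                    { refl  = λ _ → refl
                    ; sym   = λ e n → sym (e n)
                    ; trans = λ e e′ n → trans (e n) (e′ n)
                    }
                  ; ∙-cong = λ e e′ n → +-cong (e n) (e′ n)
                  }
                ; assoc = λ _ _ _ _ → +-assoc _ _ _
                }
              ; identity = (λ _ _ → +-identityˡ _) , (λ _ _ → +-identityʳ _)
              }
            ; inverse = (λ _ _ → -‿inverseˡ _) , (λ _ _ → -‿inverseʳ _)
            ; ⁻¹-cong = λ e n → -‿cong (e n)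
            }
          ; comm = λ _ _ _ → +-comm _ _
          }
        ; *-cong = ⊛-cong
        ; *-assoc = ⊛-assoc
        ; *-identity = ⊛-identityˡ , λ a n → trans (⊛-comm a one n) (⊛-identityˡ a n)
        ; distrib = ⊛-distribˡ , ⊛-distribʳ
        }
      ; *-comm = ⊛-comm
      }
    }

-- Powers, contracting recursions and composition of series.

module Composition {c ℓ : Level} (K : Field c ℓ) where
  open PowerSeries K public
    using (Series; Carrier; _⊛_; _⊕_; _^ˢ_; _∘ˢ_; _≋_; _≈_; one; X; 0#; 1#; 0ˢ; tail; const; scale; deriv;
           fromℕ; sumTo; sumTo-cong; sumTo-suc; ⊛-suc; ⊛-cong-≤; const-⊛; one≋const; 0ˢ-⊛; seriesRing)
  open CommutativeRing seriesRing public
    using (refl; sym; trans; setoid; +-cong; +-congˡ; +-congʳ; *-cong; *-congˡ; *-congʳ;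
           +-identityˡ; +-identityʳ; *-assoc; *-comm; *-identityˡ; *-identityʳ; zeroʳ; distribˡ; +-group)
  open import Relation.Binary.Reasoning.Setoid setoid public
  open import Algebra.Solver.Ring.NaturalCoefficients.Default
    (CommutativeRing.commutativeSemiring seriesRing) public
    using (solve; _:=_; _:+_; _:*_; con)
  module K = PowerSeries K

  X-⊛-zero : ∀ a → (X ⊛ a) 0 ≈ 0#
  X-⊛-zero a = K.zeroˡ _

  X-⊛-suc : ∀ a n → (X ⊛ a) (suc n) ≈ a n
  X-⊛-suc a n = K.trans (⊛-suc X a n)
    (K.trans (K.+-cong (K.zeroˡ _) (K.trans (*-congʳ {a} tail-X n) (*-identityˡ a n))) (K.+-identityˡ _))
    where
    tail-X : tail X ≋ one
    tail-X zero    = K.refl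
    tail-X (suc n) = K.refl

  X-cancel : ∀ a b → X ⊛ a ≋ X ⊛ b → a ≋ b
  X-cancel a b e n = K.trans (K.sym (X-⊛-suc a n)) (K.trans (e (suc n)) (X-⊛-suc b n))

  head-tail : ∀ a → a ≋ const (a 0) ⊕ X ⊛ tail a
  head-tail a zero    = K.sym (K.trans (K.+-congˡ (X-⊛-zero (tail a))) (K.+-identityʳ _))
  head-tail a (suc n) = K.sym (K.trans (K.+-identityˡ _) (X-⊛-suc (tail a) n))

  const-cong : ∀ {x y} → x ≈ y → const x ≋ const y
  const-cong e zero    = e
  const-cong e (suc n) = K.refl

  const-0 : const 0# ≋ 0ˢ
  const-0 zero    = K.refl
  const-0 (suc n) = K.refl

  const-+ : ∀ x y → const (x K.+ᴷ y) ≋ const x ⊕ const y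
  const-+ x y zero    = K.refl
  const-+ x y (suc n) = K.sym (K.+-identityˡ _)

  X-tail : ∀ a → a 0 ≈ 0# → a ≋ X ⊛ tail a
  X-tail a a₀ = begin
    a                        ≈⟨ head-tail a ⟩
    const (a 0) ⊕ X ⊛ tail a ≈⟨ +-congʳ (trans (const-cong a₀) const-0) ⟩
    0ˢ ⊕ X ⊛ tail a          ≈⟨ +-identityˡ (X ⊛ tail a) ⟩
    X ⊛ tail a               ∎

  ^-cong : ∀ {a b} k → a ≋ b → a ^ˢ k ≋ b ^ˢ k
  ^-cong zero    e = refl
  ^-cong (suc k) e = *-cong e (^-cong k e)

  ^-+ : ∀ a m n → a ^ˢ (m + n) ≋ a ^ˢ m ⊛ a ^ˢ n
  ^-+ a zero    n = sym (*-identityˡ (a ^ˢ n))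
  ^-+ a (suc m) n = trans (*-congˡ (^-+ a m n)) (sym (*-assoc a (a ^ˢ m) (a ^ˢ n)))

  ^-⊛ : ∀ a b k → (a ⊛ b) ^ˢ k ≋ a ^ˢ k ⊛ b ^ˢ k
  ^-⊛ a b zero    = sym (*-identityˡ one)
  ^-⊛ a b (suc k) = trans (*-congˡ (^-⊛ a b k))
    (solve 4 (λ a b x y → (a :* b) :* (x :* y) := (a :* x) :* (b :* y)) refl a b (a ^ˢ k) (b ^ˢ k))

  one-^ : ∀ k → one ^ˢ k ≋ one
  one-^ zero    = refl
  one-^ (suc k) = trans (*-identityˡ (one ^ˢ k)) (one-^ k)

  ^-* : ∀ a m n → a ^ˢ (m * n) ≋ (a ^ˢ m) ^ˢ n
  ^-* a zero    n = sym (one-^ n)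
  ^-* a (suc m) n = begin
    a ^ˢ (n + m * n)        ≈⟨ ^-+ a n (m * n) ⟩
    a ^ˢ n ⊛ a ^ˢ (m * n)   ≈⟨ *-congˡ (^-* a m n) ⟩
    a ^ˢ n ⊛ (a ^ˢ m) ^ˢ n  ≈⟨ ^-⊛ a (a ^ˢ m) n ⟨
    (a ⊛ a ^ˢ m) ^ˢ n       ∎

  X^-⊛-+ : ∀ m a n → (X ^ˢ m ⊛ a) (m + n) ≈ a n
  X^-⊛-+ zero    a n = *-identityˡ a n
  X^-⊛-+ (suc m) a n = K.trans (*-assoc X (X ^ˢ m) a (suc m + n))
    (K.trans (X-⊛-suc (X ^ˢ m ⊛ a) (m + n)) (X^-⊛-+ m a n))

  X^-⊛-< : ∀ m a {n} → suc n ≤ m → (X ^ˢ m ⊛ a) n ≈ 0#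
  X^-⊛-< (suc m) a {zero}  _         = K.trans (*-assoc X (X ^ˢ m) a 0) (X-⊛-zero (X ^ˢ m ⊛ a))
  X^-⊛-< (suc m) a {suc n} (s≤s n<m) = K.trans (*-assoc X (X ^ˢ m) a (suc n))
    (K.trans (X-⊛-suc (X ^ˢ m ⊛ a) n) (X^-⊛-< m a n<m))

  X^-cancel : ∀ m a b → X ^ˢ m ⊛ a ≋ X ^ˢ m ⊛ b → a ≋ b
  X^-cancel m a b e n = K.trans (K.sym (X^-⊛-+ m a n)) (K.trans (e (m + n)) (X^-⊛-+ m b n))

  -- A series without constant term is divisible by `X`, so its `m`-th power is divisible by
  -- `X ^ˢ m`.
  ^-⊛-< : ∀ φ → φ 0 ≈ 0# → ∀ m a {n} → suc n ≤ m → (φ ^ˢ m ⊛ a) n ≈ 0#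
  ^-⊛-< φ φ₀ m a {n} n<m = K.trans (expand n) (X^-⊛-< m (tail φ ^ˢ m ⊛ a) n<m)
    where
    expand : φ ^ˢ m ⊛ a ≋ X ^ˢ m ⊛ (tail φ ^ˢ m ⊛ a)
    expand = begin
      φ ^ˢ m ⊛ a                    ≈⟨ *-congʳ {a} (^-cong m (X-tail φ φ₀)) ⟩
      (X ⊛ tail φ) ^ˢ m ⊛ a         ≈⟨ *-congʳ {a} (^-⊛ X (tail φ) m) ⟩
      X ^ˢ m ⊛ tail φ ^ˢ m ⊛ a      ≈⟨ *-assoc (X ^ˢ m) (tail φ ^ˢ m) a ⟩
      X ^ˢ m ⊛ (tail φ ^ˢ m ⊛ a)    ∎

  -- Multiplication by m with m(0) = 0 is contracting, so the recursion determines L.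
  unique : ∀ {ι} {I : Set ι} m → m 0 ≈ 0# → (L R : I → Series) (s : I → Series) (T : I → I) →
           (∀ i → L i ≋ s i ⊕ m ⊛ L (T i)) → (∀ i → R i ≋ s i ⊕ m ⊛ R (T i)) →
           ∀ i → L i ≋ R i
  unique {I = I} m m₀ L R s T eL eR i n = below (suc n) i n ℕₚ.≤-refl
    where
    m₀-*ᴷ : ∀ x → m 0 K.*ᴷ x ≈ 0#
    m₀-*ᴷ x = K.trans (K.*-congʳ m₀) (K.zeroˡ x)
    step : ∀ {a b} n → (∀ k → suc k ≤ n → a k ≈ b k) → ∀ k → suc k ≤ suc n → (m ⊛ a) k ≈ (m ⊛ b) k
    step n e zero _ = K.trans (m₀-*ᴷ _) (K.sym (m₀-*ᴷ _))
    step {a} {b} n e (suc k) (s≤s k<n) = K.begin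
      (m ⊛ a) (suc k)                             K.≈⟨ ⊛-suc m a k ⟩
      m 0 K.*ᴷ a (suc k) K.+ᴷ (tail m ⊛ a) k
        K.≈⟨ K.+-cong (K.trans (m₀-*ᴷ _) (K.sym (m₀-*ᴷ _)))
               (⊛-cong-≤ k (λ _ _ → K.refl) λ j j≤k → e j (ℕₚ.≤-trans (s≤s j≤k) k<n)) ⟩
      m 0 K.*ᴷ b (suc k) K.+ᴷ (tail m ⊛ b) k      K.≈⟨ ⊛-suc m b k ⟨
      (m ⊛ b) (suc k)                             K.∎
    -- The recursion passes from `i` to `T i`, so the induction on the degree bound treats all
    -- indices at once.
    below : ∀ n i k → suc k ≤ n → L i k ≈ R i k
    below (suc n) i k k<n = K.trans (eL i k)
      (K.trans (K.+-congˡ (step n (below n (T i)) k k<n)) (K.sym (eR i k)))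

  seriesSum : ℕ → (ℕ → Series) → Series
  seriesSum m a n = sumTo m (λ i → a i n)

  ⊛-seriesSum : ∀ b m a → b ⊛ seriesSum m a ≋ seriesSum m (λ i → b ⊛ a i)
  ⊛-seriesSum b zero    a = refl
  ⊛-seriesSum b (suc m) a = trans (distribˡ b (seriesSum m a) (a (suc m))) (+-congʳ (⊛-seriesSum b m a))

  sumTo-extend : ∀ (a : Series) {m n} → m ≤ n → (∀ i → suc m ≤ i → a i ≈ 0#) → sumTo m a ≈ sumTo n a
  sumTo-extend a {m} m≤n e = go (ℕₚ.≤⇒≤′ m≤n)
    where
    go : ∀ {n} → m ≤′ n → sumTo m a ≈ sumTo n a
    go ≤′-refl       = K.refl
    go (≤′-step {n} m≤n) = K.trans (go m≤n)
      (K.trans (K.sym (K.+-identityʳ _)) (K.+-congˡ (K.sym (e (suc n) (s≤s (ℕₚ.≤′⇒≤ m≤n))))))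

  module _ (φ : Series) (φ₀ : φ 0 ≈ 0#) where

    -- Σ_N φ^N a_N; since φ(0) = 0, only the terms N ≤ n contribute to the coefficient of tⁿ.
    powerSum : (ℕ → Series) → Series
    powerSum a n = sumTo n (λ N → (φ ^ˢ N ⊛ a N) n)

    powerSum-cong : ∀ {a b} → (∀ N → a N ≋ b N) → powerSum a ≋ powerSum b
    powerSum-cong e n = sumTo-cong n λ N _ → *-congˡ {φ ^ˢ N} (e N) n

    -- This puts sums over powers of `φ` in the form required by `unique`, with the shift of the
    -- sequence as the step on indices.
    powerSum-suc : ∀ a → powerSum a ≋ a 0 ⊕ φ ⊛ powerSum (λ N → a (suc N))
    powerSum-suc a zero = K.trans (*-identityˡ (a 0) 0)
      (K.sym (K.trans (K.+-congˡ (K.trans (K.*-congʳ φ₀) (K.zeroˡ _))) (K.+-identityʳ _)))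
    powerSum-suc a (suc n) = K.trans (sumTo-suc n λ N → (φ ^ˢ N ⊛ a N) (suc n))
      (K.+-cong (*-identityˡ (a 0) (suc n)) (K.sym shifted))
      where
      a′ : ℕ → Series
      a′ N = a (suc N)
      terms : ℕ → Series
      terms N = φ ^ˢ N ⊛ a′ N
      χ-factor : ∀ b → φ ⊛ b ≋ X ⊛ (tail φ ⊛ b)
      χ-factor b = trans (*-congʳ {b} (X-tail φ φ₀)) (*-assoc X (tail φ) b)
      χ-suc : ∀ b n → (φ ⊛ b) (suc n) ≈ (tail φ ⊛ b) n
      χ-suc b n = K.trans (χ-factor b (suc n)) (X-⊛-suc (tail φ ⊛ b) n)
      shifted : (φ ⊛ powerSum a′) (suc n) ≈ sumTo n (λ N → (φ ^ˢ suc N ⊛ a′ N) (suc n))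
      shifted = K.begin
        (φ ⊛ powerSum a′) (suc n)
          K.≈⟨ χ-suc (powerSum a′) n ⟩
        (tail φ ⊛ powerSum a′) n
          -- Coefficient `i` of the inner sum is cut off at `i`. Extending every cut-off to the
          -- common bound `n` adds only vanishing terms, and the resulting finite sum can be moved
          -- out of the product.
          K.≈⟨ ⊛-cong-≤ n (λ _ _ → K.refl) (λ i i≤n → sumTo-extend (λ N → terms N i) i≤n
                 λ N i<N → ^-⊛-< φ φ₀ N (a′ N) i<N) ⟩
        (tail φ ⊛ seriesSum n terms) n
          K.≈⟨ ⊛-seriesSum (tail φ) n terms n ⟩
        sumTo n (λ N → (tail φ ⊛ terms N) n)
          K.≈⟨ sumTo-cong n (λ N _ → K.trans (K.sym (χ-suc (terms N) n)) (K.sym (*-assoc φ (φ ^ˢ N) (a′ N) (suc n)))) ⟩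
        sumTo n (λ N → (φ ^ˢ suc N ⊛ a′ N) (suc n)) K.∎

    powerSum-⊕ : ∀ a b → powerSum (λ N → a N ⊕ b N) ≋ powerSum a ⊕ powerSum b
    powerSum-⊕ a b n = K.trans (sumTo-cong n λ N _ → distribˡ (φ ^ˢ N) (a N) (b N) n)
      (K.sumTo-+ n (λ N → (φ ^ˢ N ⊛ a N) n) (λ N → (φ ^ˢ N ⊛ b N) n))

    powerSum-⊛ : ∀ b a → powerSum (λ N → b ⊛ a N) ≋ b ⊛ powerSum a
    powerSum-⊛ b = unique φ φ₀
      (λ a → powerSum (λ N → b ⊛ a N)) (λ a → b ⊛ powerSum a)
      (λ a → b ⊛ a 0) (λ a N → a (suc N))
      (λ a → powerSum-suc (λ N → b ⊛ a N))
      (λ a → trans (*-congˡ {b} (powerSum-suc a))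
        (solve 4 (λ b x p y → b :* (x :+ p :* y) := b :* x :+ p :* (b :* y)) refl
          b (a 0) φ (powerSum (λ N → a (suc N)))))

    ∘-powerSum : ∀ a → a ∘ˢ φ ≋ powerSum (λ N → const (a N))
    ∘-powerSum a n = sumTo-cong n λ N _ → K.sym
      (K.trans (*-comm (φ ^ˢ N) (const (a N)) n) (const-⊛ (a N) (φ ^ˢ N) n))

    -- Horner's rule. The additive, multiplicative and associative laws of composition follow by
    -- showing that both sides obey this type of recursion and applying `unique`.
    ∘-tail : ∀ a → a ∘ˢ φ ≋ const (a 0) ⊕ φ ⊛ (tail a ∘ˢ φ)
    ∘-tail a = begin
      a ∘ˢ φ                                                    ≈⟨ ∘-powerSum a ⟩
      powerSum (λ N → const (a N))                              ≈⟨ powerSum-suc (λ N → const (a N)) ⟩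
      const (a 0) ⊕ φ ⊛ powerSum (λ N → const (tail a N))       ≈⟨ +-congˡ (*-congˡ (∘-powerSum (tail a))) ⟨
      const (a 0) ⊕ φ ⊛ (tail a ∘ˢ φ)                           ∎

    ∘-cong : ∀ {a b} → a ≋ b → a ∘ˢ φ ≋ b ∘ˢ φ
    ∘-cong e n = sumTo-cong n λ i _ → K.*-congʳ (e i)

    ∘-X-⊛ : ∀ a → (X ⊛ a) ∘ˢ φ ≋ φ ⊛ (a ∘ˢ φ)
    ∘-X-⊛ a = begin
      (X ⊛ a) ∘ˢ φ                                   ≈⟨ ∘-tail (X ⊛ a) ⟩
      const ((X ⊛ a) 0) ⊕ φ ⊛ (tail (X ⊛ a) ∘ˢ φ)
        ≈⟨ +-cong (trans (const-cong (X-⊛-zero a)) const-0) (*-congˡ (∘-cong (X-⊛-suc a))) ⟩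
      0ˢ ⊕ φ ⊛ (a ∘ˢ φ)                              ≈⟨ +-identityˡ (φ ⊛ (a ∘ˢ φ)) ⟩
      φ ⊛ (a ∘ˢ φ)                                   ∎

    ∘-⊕ : ∀ a b → (a ⊕ b) ∘ˢ φ ≋ (a ∘ˢ φ) ⊕ (b ∘ˢ φ)
    ∘-⊕ a b = unique φ φ₀
      (λ (a , b) → (a ⊕ b) ∘ˢ φ) (λ (a , b) → (a ∘ˢ φ) ⊕ (b ∘ˢ φ))
      (λ (a , b) → const (a 0) ⊕ const (b 0)) (λ (a , b) → tail a , tail b)
      (λ (a , b) → trans (∘-tail (a ⊕ b)) (+-congʳ (const-+ (a 0) (b 0))))
      (λ (a , b) → trans (+-cong (∘-tail a) (∘-tail b))
        (solve 5 (λ x y p u v → (x :+ p :* u) :+ (y :+ p :* v) := (x :+ y) :+ p :* (u :+ v)) refl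
          (const (a 0)) (const (b 0)) φ (tail a ∘ˢ φ) (tail b ∘ˢ φ)))
      (a , b)

    ∘-const-⊛ : ∀ x a → (const x ⊛ a) ∘ˢ φ ≋ const x ⊛ (a ∘ˢ φ)
    ∘-const-⊛ x a = trans (∘-cong (const-⊛ x a)) (trans scaled (sym (const-⊛ x (a ∘ˢ φ))))
      where
      scaled : scale x a ∘ˢ φ ≋ scale x (a ∘ˢ φ)
      scaled n = K.trans (sumTo-cong n λ i _ → K.*-assoc _ _ _) (K.sumTo-*ˡ n x λ i → a i K.*ᴷ (φ ^ˢ i) n)

    ∘-const : ∀ x → const x ∘ˢ φ ≋ const x
    ∘-const x = begin
      const x ∘ˢ φ               ≈⟨ ∘-tail (const x) ⟩
      const x ⊕ φ ⊛ (0ˢ ∘ˢ φ)    ≈⟨ +-congˡ (*-congˡ 0∘) ⟩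
      const x ⊕ φ ⊛ 0ˢ           ≈⟨ +-congˡ (zeroʳ φ) ⟩
      const x ⊕ 0ˢ               ≈⟨ +-identityʳ (const x) ⟩
      const x                    ∎
      where
      0∘ : 0ˢ ∘ˢ φ ≋ 0ˢ
      0∘ = begin
        0ˢ ∘ˢ φ                  ≈⟨ ∘-cong (zeroʳ (const 0#)) ⟨
        (const 0# ⊛ 0ˢ) ∘ˢ φ     ≈⟨ ∘-const-⊛ 0# 0ˢ ⟩
        const 0# ⊛ (0ˢ ∘ˢ φ)     ≈⟨ *-congʳ {0ˢ ∘ˢ φ} const-0 ⟩
        0ˢ ⊛ (0ˢ ∘ˢ φ)           ≈⟨ 0ˢ-⊛ (0ˢ ∘ˢ φ) ⟩
        0ˢ                       ∎

    ∘-⊛ : ∀ a b → (a ⊛ b) ∘ˢ φ ≋ (a ∘ˢ φ) ⊛ (b ∘ˢ φ)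
    ∘-⊛ a b = unique φ φ₀
      (λ a → (a ⊛ b) ∘ˢ φ) (λ a → (a ∘ˢ φ) ⊛ (b ∘ˢ φ))
      (λ a → const (a 0) ⊛ (b ∘ˢ φ)) tail
      (λ a → begin
        (a ⊛ b) ∘ˢ φ
          ≈⟨ ∘-cong (*-congʳ {b} (head-tail a)) ⟩
        ((const (a 0) ⊕ X ⊛ tail a) ⊛ b) ∘ˢ φ
          ≈⟨ ∘-cong (solve 4 (λ k x u b → (k :+ x :* u) :* b := k :* b :+ x :* (u :* b)) refl
               (const (a 0)) X (tail a) b) ⟩
        (const (a 0) ⊛ b ⊕ X ⊛ (tail a ⊛ b)) ∘ˢ φ
          ≈⟨ ∘-⊕ (const (a 0) ⊛ b) (X ⊛ (tail a ⊛ b)) ⟩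
        ((const (a 0) ⊛ b) ∘ˢ φ) ⊕ ((X ⊛ (tail a ⊛ b)) ∘ˢ φ)
          ≈⟨ +-cong (∘-const-⊛ (a 0) b) (∘-X-⊛ (tail a ⊛ b)) ⟩
        const (a 0) ⊛ (b ∘ˢ φ) ⊕ φ ⊛ ((tail a ⊛ b) ∘ˢ φ) ∎)
      (λ a → trans (*-congʳ {b ∘ˢ φ} (∘-tail a))
        (solve 4 (λ k p u b → (k :+ p :* u) :* b := k :* b :+ p :* (u :* b)) refl
          (const (a 0)) φ (tail a ∘ˢ φ) (b ∘ˢ φ)))
      a

    ∘-one : one ∘ˢ φ ≋ one
    ∘-one = trans (∘-cong one≋const) (trans (∘-const 1#) (sym one≋const))

    ∘-^ : ∀ a k → (a ^ˢ k) ∘ˢ φ ≋ (a ∘ˢ φ) ^ˢ k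
    ∘-^ a zero    = ∘-one
    ∘-^ a (suc k) = trans (∘-⊛ a (a ^ˢ k)) (*-congˡ (∘-^ a k))

    ∘-zero : ∀ a → a 0 ≈ 0# → (a ∘ˢ φ) 0 ≈ 0#
    ∘-zero a a₀ = K.trans (K.*-congʳ a₀) (K.zeroˡ _)

    X-∘ : X ∘ˢ φ ≋ φ
    X-∘ = begin
      X ∘ˢ φ         ≈⟨ ∘-cong (*-identityʳ X) ⟨
      (X ⊛ one) ∘ˢ φ ≈⟨ ∘-X-⊛ one ⟩
      φ ⊛ (one ∘ˢ φ) ≈⟨ *-congˡ ∘-one ⟩
      φ ⊛ one        ≈⟨ *-identityʳ φ ⟩
      φ              ∎

  -- Both sides obey Horner's rule with multiplier `f ∘ˢ φ`, whose constant term vanishes.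
  ∘-assoc : ∀ a f φ → f 0 ≈ 0# → φ 0 ≈ 0# → (a ∘ˢ f) ∘ˢ φ ≋ a ∘ˢ (f ∘ˢ φ)
  ∘-assoc a f φ f₀ φ₀ = unique (f ∘ˢ φ) F₀
    (λ a → (a ∘ˢ f) ∘ˢ φ) (λ a → a ∘ˢ (f ∘ˢ φ)) (λ a → const (a 0)) tail
    (λ a → begin
      (a ∘ˢ f) ∘ˢ φ
        ≈⟨ ∘-cong φ φ₀ (∘-tail f f₀ a) ⟩
      (const (a 0) ⊕ f ⊛ (tail a ∘ˢ f)) ∘ˢ φ
        ≈⟨ ∘-⊕ φ φ₀ (const (a 0)) (f ⊛ (tail a ∘ˢ f)) ⟩
      (const (a 0) ∘ˢ φ) ⊕ ((f ⊛ (tail a ∘ˢ f)) ∘ˢ φ)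
        ≈⟨ +-cong (∘-const φ φ₀ (a 0)) (∘-⊛ φ φ₀ f (tail a ∘ˢ f)) ⟩
      const (a 0) ⊕ (f ∘ˢ φ) ⊛ ((tail a ∘ˢ f) ∘ˢ φ) ∎)
    (∘-tail (f ∘ˢ φ) F₀)
    a
    where
    F₀ : (f ∘ˢ φ) 0 ≈ 0#
    F₀ = ∘-zero φ φ₀ f f₀

-- The formal derivative: product rule and chain rule.

module Derivation {c ℓ : Level} (K : Field c ℓ) where
  open Composition K

  deriv-cong : ∀ {a b} → a ≋ b → deriv a ≋ deriv b
  deriv-cong e n = K.*-congˡ (e (suc n))

  deriv-⊕ : ∀ a b → deriv (a ⊕ b) ≋ deriv a ⊕ deriv b
  deriv-⊕ a b n = K.distribˡ _ _ _

  deriv-const-⊕ : ∀ x a → deriv (const x ⊕ a) ≋ deriv a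
  deriv-const-⊕ x a n = K.*-congˡ (K.+-identityˡ _)

  -- The factor n + 1 in the derivative is split as 1 + n; the part with n is t times the derivative
  -- of the tail.
  deriv-tail : ∀ a → deriv a ≋ tail a ⊕ X ⊛ deriv (tail a)
  deriv-tail a n = K.trans (K.distribʳ _ _ _) (K.+-cong (K.*-identityˡ _) (shifted n))
    where
    shifted : ∀ n → fromℕ n K.*ᴷ a (suc n) ≈ (X ⊛ deriv (tail a)) n
    shifted zero    = K.trans (K.zeroˡ _) (K.sym (X-⊛-zero (deriv (tail a))))
    shifted (suc n) = K.sym (X-⊛-suc (deriv (tail a)) n)

  deriv-X-⊛ : ∀ a → deriv (X ⊛ a) ≋ a ⊕ X ⊛ deriv a
  deriv-X-⊛ a = trans (deriv-tail (X ⊛ a))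
    (+-cong (X-⊛-suc a) (*-congˡ (deriv-cong (X-⊛-suc a))))

  deriv-const-⊛ : ∀ x a → deriv (const x ⊛ a) ≋ const x ⊛ deriv a
  deriv-const-⊛ x a n = K.begin
    fromℕ (suc n) K.*ᴷ (const x ⊛ a) (suc n)  K.≈⟨ K.*-congˡ (const-⊛ x a (suc n)) ⟩
    fromℕ (suc n) K.*ᴷ (x K.*ᴷ a (suc n))     K.≈⟨ K.*-assoc _ _ _ ⟨
    (fromℕ (suc n) K.*ᴷ x) K.*ᴷ a (suc n)     K.≈⟨ K.*-congʳ (K.*-comm _ _) ⟩
    (x K.*ᴷ fromℕ (suc n)) K.*ᴷ a (suc n)     K.≈⟨ K.*-assoc _ _ _ ⟩
    x K.*ᴷ deriv a n                          K.≈⟨ const-⊛ x (deriv a) n ⟨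
    (const x ⊛ deriv a) n                     K.∎

  -- Recursion on the first factor with multiplier `X`; the summand `tail a ⊛ b` comes from
  -- differentiating that `X`.
  deriv-⊛ : ∀ a b → deriv (a ⊛ b) ≋ deriv a ⊛ b ⊕ a ⊛ deriv b
  deriv-⊛ a b = unique X K.refl
    (λ a → deriv (a ⊛ b)) (λ a → deriv a ⊛ b ⊕ a ⊛ deriv b)
    (λ a → const (a 0) ⊛ deriv b ⊕ tail a ⊛ b) tail
    (λ a → begin
      deriv (a ⊛ b)
        ≈⟨ deriv-cong (*-congʳ {b} (head-tail a)) ⟩
      deriv ((const (a 0) ⊕ X ⊛ tail a) ⊛ b)
        ≈⟨ deriv-cong (solve 4 (λ k x u b → (k :+ x :* u) :* b := k :* b :+ x :* (u :* b)) refl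
             (const (a 0)) X (tail a) b) ⟩
      deriv (const (a 0) ⊛ b ⊕ X ⊛ (tail a ⊛ b))
        ≈⟨ deriv-⊕ (const (a 0) ⊛ b) (X ⊛ (tail a ⊛ b)) ⟩
      deriv (const (a 0) ⊛ b) ⊕ deriv (X ⊛ (tail a ⊛ b))
        ≈⟨ +-cong (deriv-const-⊛ (a 0) b) (deriv-X-⊛ (tail a ⊛ b)) ⟩
      const (a 0) ⊛ deriv b ⊕ (tail a ⊛ b ⊕ X ⊛ deriv (tail a ⊛ b))
        ≈⟨ solve 3 (λ x y z → x :+ (y :+ z) := (x :+ y) :+ z) refl
             (const (a 0) ⊛ deriv b) (tail a ⊛ b) (X ⊛ deriv (tail a ⊛ b)) ⟩
      (const (a 0) ⊛ deriv b ⊕ tail a ⊛ b) ⊕ X ⊛ deriv (tail a ⊛ b) ∎)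
    (λ a → begin
      deriv a ⊛ b ⊕ a ⊛ deriv b
        ≈⟨ +-cong (*-congʳ {b} (deriv-tail a)) (*-congʳ {deriv b} (head-tail a)) ⟩
      (tail a ⊕ X ⊛ deriv (tail a)) ⊛ b ⊕ (const (a 0) ⊕ X ⊛ tail a) ⊛ deriv b
        ≈⟨ solve 6 (λ u x u′ b k b′ → (u :+ x :* u′) :* b :+ (k :+ x :* u) :* b′
                                   := (k :* b′ :+ u :* b) :+ x :* (u′ :* b :+ u :* b′)) refl
             (tail a) X (deriv (tail a)) b (const (a 0)) (deriv b) ⟩
      (const (a 0) ⊛ deriv b ⊕ tail a ⊛ b) ⊕ X ⊛ (deriv (tail a) ⊛ b ⊕ tail a ⊛ deriv b) ∎)
    a

  deriv-∘-tail : ∀ φ → φ 0 ≈ 0# → ∀ a → deriv a ∘ˢ φ ≋ (tail a ∘ˢ φ) ⊕ φ ⊛ (deriv (tail a) ∘ˢ φ)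
  deriv-∘-tail φ φ₀ a = begin
    deriv a ∘ˢ φ                                  ≈⟨ ∘-cong φ φ₀ (deriv-tail a) ⟩
    (tail a ⊕ X ⊛ deriv (tail a)) ∘ˢ φ            ≈⟨ ∘-⊕ φ φ₀ (tail a) (X ⊛ deriv (tail a)) ⟩
    (tail a ∘ˢ φ) ⊕ ((X ⊛ deriv (tail a)) ∘ˢ φ)   ≈⟨ +-congˡ (∘-X-⊛ φ φ₀ (deriv (tail a))) ⟩
    (tail a ∘ˢ φ) ⊕ φ ⊛ (deriv (tail a) ∘ˢ φ)     ∎

  -- Differentiating Horner's rule by the product rule gives a recursion with multiplier `φ`, which
  -- the right-hand side obeys as well.
  deriv-∘ : ∀ φ → φ 0 ≈ 0# → ∀ a → deriv (a ∘ˢ φ) ≋ (deriv a ∘ˢ φ) ⊛ deriv φ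
  deriv-∘ φ φ₀ = unique φ φ₀
    (λ a → deriv (a ∘ˢ φ)) (λ a → (deriv a ∘ˢ φ) ⊛ deriv φ)
    (λ a → deriv φ ⊛ (tail a ∘ˢ φ)) tail
    (λ a → begin
      deriv (a ∘ˢ φ)                            ≈⟨ deriv-cong (∘-tail φ φ₀ a) ⟩
      deriv (const (a 0) ⊕ φ ⊛ (tail a ∘ˢ φ))   ≈⟨ deriv-const-⊕ (a 0) (φ ⊛ (tail a ∘ˢ φ)) ⟩
      deriv (φ ⊛ (tail a ∘ˢ φ))                 ≈⟨ deriv-⊛ φ (tail a ∘ˢ φ) ⟩
      deriv φ ⊛ (tail a ∘ˢ φ) ⊕ φ ⊛ deriv (tail a ∘ˢ φ) ∎)
    (λ a → begin
      (deriv a ∘ˢ φ) ⊛ deriv φ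
        ≈⟨ *-congʳ {deriv φ} (deriv-∘-tail φ φ₀ a) ⟩
      ((tail a ∘ˢ φ) ⊕ φ ⊛ (deriv (tail a) ∘ˢ φ)) ⊛ deriv φ
        ≈⟨ solve 4 (λ u p u′ p′ → (u :+ p :* u′) :* p′ := p′ :* u :+ p :* (u′ :* p′)) refl
             (tail a ∘ˢ φ) φ (deriv (tail a) ∘ˢ φ) (deriv φ) ⟩
      deriv φ ⊛ (tail a ∘ˢ φ) ⊕ φ ⊛ ((deriv (tail a) ∘ˢ φ) ⊛ deriv φ) ∎)

-- Lagrange inversion in arbitrary characteristic.

module Lagrange {c ℓ : Level} (K : Field c ℓ) where
  open Composition K
  open Derivation K
  open import Algebra.Properties.Group +-group using (∙-cancelʳ)

  module _ (U φ : Series) (φ₀ : φ 0 ≈ 0#) (φ-eq : φ ≋ X ⊛ (U ∘ˢ φ)) where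

    -- The coefficient of tⁿ in Λ N H is [t^(N+n)] H Uⁿ; the shift N plays the role of a factor t^(-N).
    Λ : ℕ → Series → Series
    Λ N H n = (H ⊛ U ^ˢ n) (N + n)

    Λ-cong : ∀ N {H H′} → H ≋ H′ → Λ N H ≋ Λ N H′
    Λ-cong N e n = *-congʳ {U ^ˢ n} e (N + n)

    Λ-⊕ : ∀ N a b → Λ N (a ⊕ b) ≋ Λ N a ⊕ Λ N b
    Λ-⊕ N a b n = K.⊛-distribʳ (U ^ˢ n) a b (N + n)

    Λ-const-⊛ : ∀ N x H → Λ N (const x ⊛ H) ≋ const x ⊛ Λ N H
    Λ-const-⊛ N x H n = K.begin
      ((const x ⊛ H) ⊛ U ^ˢ n) (N + n)   K.≈⟨ *-assoc (const x) H (U ^ˢ n) (N + n) ⟩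
      (const x ⊛ (H ⊛ U ^ˢ n)) (N + n)   K.≈⟨ const-⊛ x (H ⊛ U ^ˢ n) (N + n) ⟩
      x K.*ᴷ (H ⊛ U ^ˢ n) (N + n)        K.≈⟨ const-⊛ x (Λ N H) n ⟨
      (const x ⊛ Λ N H) n                K.∎

    Λ-X : ∀ N H → Λ (suc N) (X ⊛ H) ≋ Λ N H
    Λ-X N H n = K.trans (*-assoc X H (U ^ˢ n) (suc (N + n))) (X-⊛-suc (H ⊛ U ^ˢ n) (N + n))

    -- One factor `U` of the power is absorbed into `H`, and the degree `N + suc n` is reread as
    -- `suc N + n`. Only the coefficient with n = 0, where there is no factor to absorb, stays
    -- outside.
    Λ-step : ∀ N H → Λ N H ≋ const (H N) ⊕ X ⊛ Λ (suc N) (U ⊛ H)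
    Λ-step N H zero = K.begin
      (H ⊛ one) (N + 0)                               K.≈⟨ *-identityʳ H (N + 0) ⟩
      H (N + 0)                                       K.≡⟨ ≡.cong H (ℕₚ.+-identityʳ N) ⟩
      H N                                             K.≈⟨ K.+-identityʳ _ ⟨
      H N K.+ᴷ 0#                                     K.≈⟨ K.+-congˡ (X-⊛-zero (Λ (suc N) (U ⊛ H))) ⟨
      (const (H N) ⊕ X ⊛ Λ (suc N) (U ⊛ H)) 0         K.∎
    Λ-step N H (suc n) = K.begin
      (H ⊛ U ^ˢ suc n) (N + suc n)                    K.≡⟨ ≡.cong (H ⊛ U ^ˢ suc n) (ℕₚ.+-suc N n) ⟩
      (H ⊛ U ^ˢ suc n) (suc N + n)
        K.≈⟨ solve 3 (λ h u v → h :* (u :* v) := (u :* h) :* v) refl H U (U ^ˢ n) (suc N + n) ⟩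
      Λ (suc N) (U ⊛ H) n                             K.≈⟨ X-⊛-suc (Λ (suc N) (U ⊛ H)) n ⟨
      (X ⊛ Λ (suc N) (U ⊛ H)) (suc n)                 K.≈⟨ K.+-identityˡ _ ⟨
      (const (H N) ⊕ X ⊛ Λ (suc N) (U ⊛ H)) (suc n)   K.∎

    -- The leading coefficient of `X ⊛ H` vanishes, and the factor `X` cancels the shift that
    -- `Λ-step` creates.
    Λ-X-zero : ∀ H → Λ 0 (X ⊛ H) ≋ X ⊛ Λ 0 (U ⊛ H)
    Λ-X-zero H = begin
      Λ 0 (X ⊛ H)                                   ≈⟨ Λ-step 0 (X ⊛ H) ⟩
      const ((X ⊛ H) 0) ⊕ X ⊛ Λ 1 (U ⊛ (X ⊛ H))
        ≈⟨ +-cong (trans (const-cong (X-⊛-zero H)) const-0)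
                  (*-congˡ (Λ-cong 1 (solve 3 (λ u x h → u :* (x :* h) := x :* (u :* h)) refl U X H))) ⟩
      0ˢ ⊕ X ⊛ Λ 1 (X ⊛ (U ⊛ H))                    ≈⟨ +-identityˡ (X ⊛ Λ 1 (X ⊛ (U ⊛ H))) ⟩
      X ⊛ Λ 1 (X ⊛ (U ⊛ H))                         ≈⟨ *-congˡ (Λ-X 0 (U ⊛ H)) ⟩
      X ⊛ Λ 0 (U ⊛ H)                               ∎

    -- The recursion sends `Q` to `U ⊛ tail Q`, and contraction comes from the multiplier `X`. The
    -- right-hand side obeys it because `φ-eq` turns the `φ` of Horner's rule into `X ⊛ (U ∘ˢ φ)`.
    Λ-∘ : ∀ Q H → Λ 0 (Q ⊛ H) ≋ (Q ∘ˢ φ) ⊛ Λ 0 H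
    Λ-∘ Q H = unique X K.refl
      (λ Q → Λ 0 (Q ⊛ H)) (λ Q → (Q ∘ˢ φ) ⊛ Λ 0 H)
      (λ Q → const (Q 0) ⊛ Λ 0 H) (λ Q → U ⊛ tail Q)
      (λ Q → begin
        Λ 0 (Q ⊛ H)
          ≈⟨ Λ-cong 0 (*-congʳ {H} (head-tail Q)) ⟩
        Λ 0 ((const (Q 0) ⊕ X ⊛ tail Q) ⊛ H)
          ≈⟨ Λ-cong 0 (solve 4 (λ k x q h → (k :+ x :* q) :* h := k :* h :+ x :* (q :* h)) refl
               (const (Q 0)) X (tail Q) H) ⟩
        Λ 0 (const (Q 0) ⊛ H ⊕ X ⊛ (tail Q ⊛ H))
          ≈⟨ Λ-⊕ 0 (const (Q 0) ⊛ H) (X ⊛ (tail Q ⊛ H)) ⟩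
        Λ 0 (const (Q 0) ⊛ H) ⊕ Λ 0 (X ⊛ (tail Q ⊛ H))
          ≈⟨ +-cong (Λ-const-⊛ 0 (Q 0) H) (Λ-X-zero (tail Q ⊛ H)) ⟩
        const (Q 0) ⊛ Λ 0 H ⊕ X ⊛ Λ 0 (U ⊛ (tail Q ⊛ H))
          ≈⟨ +-congˡ (*-congˡ (Λ-cong 0 (*-assoc U (tail Q) H))) ⟨
        const (Q 0) ⊛ Λ 0 H ⊕ X ⊛ Λ 0 ((U ⊛ tail Q) ⊛ H) ∎)
      (λ Q → begin
        (Q ∘ˢ φ) ⊛ Λ 0 H
          ≈⟨ *-congʳ {Λ 0 H} (trans (∘-tail φ φ₀ Q) (+-congˡ (*-congʳ {tail Q ∘ˢ φ} φ-eq))) ⟩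
        (const (Q 0) ⊕ (X ⊛ (U ∘ˢ φ)) ⊛ (tail Q ∘ˢ φ)) ⊛ Λ 0 H
          ≈⟨ solve 5 (λ k x u q h → (k :+ (x :* u) :* q) :* h := k :* h :+ x :* ((u :* q) :* h)) refl
               (const (Q 0)) X (U ∘ˢ φ) (tail Q ∘ˢ φ) (Λ 0 H) ⟩
        const (Q 0) ⊛ Λ 0 H ⊕ X ⊛ (((U ∘ˢ φ) ⊛ (tail Q ∘ˢ φ)) ⊛ Λ 0 H)
          ≈⟨ +-congˡ (*-congˡ (*-congʳ {Λ 0 H} (∘-⊛ φ φ₀ U (tail Q)))) ⟨
        const (Q 0) ⊛ Λ 0 H ⊕ X ⊛ (((U ⊛ tail Q) ∘ˢ φ) ⊛ Λ 0 H) ∎)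
      Q

    λ₀ : Series
    λ₀ = Λ 0 one

    Λ-zero : ∀ Q → Λ 0 Q ≋ (Q ∘ˢ φ) ⊛ λ₀
    Λ-zero Q = trans (Λ-cong 0 (sym (*-identityʳ Q))) (Λ-∘ Q one)

    -- Γ Q pairs Q with the geometric series 1/(t - φ) = Σ_N φ^N t^(-N-1).
    Γ : Series → Series
    Γ Q = powerSum φ φ₀ (λ N → Λ (suc N) Q)

    powerSum-Λ : ∀ Q → powerSum φ φ₀ (λ N → Λ N Q) ≋ Λ 0 Q ⊕ φ ⊛ Γ Q
    powerSum-Λ Q = powerSum-suc φ φ₀ (λ N → Λ N Q)

    -- The factor `X` in front of `tail Q` lowers each shift by one, so the sum for `tail Q` starts
    -- at shift 0 and leaves the boundary term `Λ 0 (tail Q)`.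
    Γ-tail : ∀ Q → Γ Q ≋ const (Q 0) ⊛ Γ one ⊕ (Λ 0 (tail Q) ⊕ φ ⊛ Γ (tail Q))
    Γ-tail Q = begin
      Γ Q
        ≈⟨ powerSum-cong φ φ₀ (λ N → begin
             Λ (suc N) Q
               ≈⟨ Λ-cong (suc N) (trans (head-tail Q) (+-congʳ {X ⊛ tail Q} (sym (*-identityʳ (const (Q 0)))))) ⟩
             Λ (suc N) (const (Q 0) ⊛ one ⊕ X ⊛ tail Q)
               ≈⟨ Λ-⊕ (suc N) (const (Q 0) ⊛ one) (X ⊛ tail Q) ⟩
             Λ (suc N) (const (Q 0) ⊛ one) ⊕ Λ (suc N) (X ⊛ tail Q)
               ≈⟨ +-cong (Λ-const-⊛ (suc N) (Q 0) one) (Λ-X N (tail Q)) ⟩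
             const (Q 0) ⊛ Λ (suc N) one ⊕ Λ N (tail Q) ∎) ⟩
      powerSum φ φ₀ (λ N → const (Q 0) ⊛ Λ (suc N) one ⊕ Λ N (tail Q))
        ≈⟨ powerSum-⊕ φ φ₀ (λ N → const (Q 0) ⊛ Λ (suc N) one) (λ N → Λ N (tail Q)) ⟩
      powerSum φ φ₀ (λ N → const (Q 0) ⊛ Λ (suc N) one) ⊕ powerSum φ φ₀ (λ N → Λ N (tail Q))
        ≈⟨ +-cong (powerSum-⊛ φ φ₀ (const (Q 0)) (λ N → Λ (suc N) one)) (powerSum-Λ (tail Q)) ⟩
      const (Q 0) ⊛ Γ one ⊕ (Λ 0 (tail Q) ⊕ φ ⊛ Γ (tail Q)) ∎

    -- Formally, Q(t)/(t - φ) is Q(φ)/(t - φ) plus the difference quotient (Q(t) - Q(φ))/(t - φ). On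
    -- the latter `Λ 0` replaces t by φ, which yields Q′(φ) times `λ₀`.
    Γ-∘ : ∀ Q → Γ Q ≋ (Q ∘ˢ φ) ⊛ Γ one ⊕ (deriv Q ∘ˢ φ) ⊛ λ₀
    Γ-∘ = unique φ φ₀ Γ (λ Q → (Q ∘ˢ φ) ⊛ Γ one ⊕ (deriv Q ∘ˢ φ) ⊛ λ₀)
      (λ Q → const (Q 0) ⊛ Γ one ⊕ (tail Q ∘ˢ φ) ⊛ λ₀) tail
      (λ Q → begin
        Γ Q
          ≈⟨ Γ-tail Q ⟩
        const (Q 0) ⊛ Γ one ⊕ (Λ 0 (tail Q) ⊕ φ ⊛ Γ (tail Q))
          ≈⟨ +-congˡ (+-congʳ {φ ⊛ Γ (tail Q)} (Λ-zero (tail Q))) ⟩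
        const (Q 0) ⊛ Γ one ⊕ ((tail Q ∘ˢ φ) ⊛ λ₀ ⊕ φ ⊛ Γ (tail Q))
          ≈⟨ solve 3 (λ x y z → x :+ (y :+ z) := (x :+ y) :+ z) refl
               (const (Q 0) ⊛ Γ one) ((tail Q ∘ˢ φ) ⊛ λ₀) (φ ⊛ Γ (tail Q)) ⟩
        (const (Q 0) ⊛ Γ one ⊕ (tail Q ∘ˢ φ) ⊛ λ₀) ⊕ φ ⊛ Γ (tail Q) ∎)
      (λ Q → begin
        (Q ∘ˢ φ) ⊛ Γ one ⊕ (deriv Q ∘ˢ φ) ⊛ λ₀
          ≈⟨ +-cong (*-congʳ {Γ one} (∘-tail φ φ₀ Q)) (*-congʳ {λ₀} (deriv-∘-tail φ φ₀ Q)) ⟩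
        (const (Q 0) ⊕ φ ⊛ (tail Q ∘ˢ φ)) ⊛ Γ one ⊕ ((tail Q ∘ˢ φ) ⊕ φ ⊛ (deriv (tail Q) ∘ˢ φ)) ⊛ λ₀
          ≈⟨ solve 6 (λ k p q g q′ l → (k :+ p :* q) :* g :+ (q :+ p :* q′) :* l
                                    := (k :* g :+ q :* l) :+ p :* (q :* g :+ q′ :* l)) refl
               (const (Q 0)) φ (tail Q ∘ˢ φ) (Γ one) (deriv (tail Q) ∘ˢ φ) λ₀ ⟩
        (const (Q 0) ⊛ Γ one ⊕ (tail Q ∘ˢ φ) ⊛ λ₀)
          ⊕ φ ⊛ ((tail Q ∘ˢ φ) ⊛ Γ one ⊕ (deriv (tail Q) ∘ˢ φ) ⊛ λ₀) ∎)

    -- The sum of φ^N `Λ N one` is computed twice: splitting off N = 0 gives `λ₀ ⊕ φ ⊛ Γ one`, and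
    -- `Λ-step` gives `one ⊕ X ⊛ Γ U`. Expanding `Γ U` by `Γ-∘` produces `φ ⊛ Γ one` again, so the
    -- unevaluated `Γ one` cancels.
    λ₀-eq : λ₀ ≋ one ⊕ X ⊛ ((deriv U ∘ˢ φ) ⊛ λ₀)
    λ₀-eq = ∙-cancelʳ (φ ⊛ Γ one) λ₀ (one ⊕ X ⊛ ((deriv U ∘ˢ φ) ⊛ λ₀)) (begin
      λ₀ ⊕ φ ⊛ Γ one
        ≈⟨ powerSum-Λ one ⟨
      powerSum φ φ₀ (λ N → Λ N one)
        ≈⟨ powerSum-cong φ φ₀ (λ N → trans (Λ-step N one)
             (+-congˡ (*-congˡ (Λ-cong (suc N) (*-identityʳ U))))) ⟩
      powerSum φ φ₀ (λ N → const (one N) ⊕ X ⊛ Λ (suc N) U)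
        ≈⟨ powerSum-⊕ φ φ₀ (λ N → const (one N)) (λ N → X ⊛ Λ (suc N) U) ⟩
      powerSum φ φ₀ (λ N → const (one N)) ⊕ powerSum φ φ₀ (λ N → X ⊛ Λ (suc N) U)
        ≈⟨ +-cong (trans (sym (∘-powerSum φ φ₀ one)) (∘-one φ φ₀)) (powerSum-⊛ φ φ₀ X (λ N → Λ (suc N) U)) ⟩
      one ⊕ X ⊛ Γ U
        ≈⟨ +-congˡ (*-congˡ (Γ-∘ U)) ⟩
      one ⊕ X ⊛ ((U ∘ˢ φ) ⊛ Γ one ⊕ (deriv U ∘ˢ φ) ⊛ λ₀)
        ≈⟨ solve 5 (λ o x u g d → o :+ x :* (u :* g :+ d) := (o :+ x :* d) :+ (x :* u) :* g) refl
             one X (U ∘ˢ φ) (Γ one) ((deriv U ∘ˢ φ) ⊛ λ₀) ⟩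
      (one ⊕ X ⊛ ((deriv U ∘ˢ φ) ⊛ λ₀)) ⊕ (X ⊛ (U ∘ˢ φ)) ⊛ Γ one
        ≈⟨ +-congˡ (*-congʳ {Γ one} φ-eq) ⟨
      (one ⊕ X ⊛ ((deriv U ∘ˢ φ) ⊛ λ₀)) ⊕ φ ⊛ Γ one ∎)

    -- Differentiating `φ-eq`, and multiplying `λ₀-eq` by U(φ), give the same fixed-point equation x
    -- = U(φ) + s U′(φ) x. Its contracting multiplier makes the solution unique.
    deriv-φ : deriv φ ≋ (U ∘ˢ φ) ⊛ λ₀
    deriv-φ = unique m (X-⊛-zero (deriv U ∘ˢ φ))
      (λ _ → deriv φ) (λ _ → (U ∘ˢ φ) ⊛ λ₀) (λ _ → U ∘ˢ φ) (λ a → a)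
      (λ _ → begin
        deriv φ                                     ≈⟨ deriv-cong φ-eq ⟩
        deriv (X ⊛ (U ∘ˢ φ))                        ≈⟨ deriv-X-⊛ (U ∘ˢ φ) ⟩
        (U ∘ˢ φ) ⊕ X ⊛ deriv (U ∘ˢ φ)               ≈⟨ +-congˡ (*-congˡ (deriv-∘ φ φ₀ U)) ⟩
        (U ∘ˢ φ) ⊕ X ⊛ ((deriv U ∘ˢ φ) ⊛ deriv φ)
          ≈⟨ +-congˡ (*-assoc X (deriv U ∘ˢ φ) (deriv φ)) ⟨
        (U ∘ˢ φ) ⊕ m ⊛ deriv φ                      ∎)
      (λ _ → begin
        (U ∘ˢ φ) ⊛ λ₀                               ≈⟨ *-congˡ λ₀-eq ⟩
        (U ∘ˢ φ) ⊛ (one ⊕ X ⊛ ((deriv U ∘ˢ φ) ⊛ λ₀))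
          ≈⟨ solve 4 (λ u x d l → u :* (con 1 :+ x :* (d :* l)) := u :+ (x :* d) :* (u :* l)) refl
               (U ∘ˢ φ) X (deriv U ∘ˢ φ) λ₀ ⟩
        (U ∘ˢ φ) ⊕ m ⊛ ((U ∘ˢ φ) ⊛ λ₀)              ∎)
      φ
      where
      m : Series
      m = X ⊛ (deriv U ∘ˢ φ)

-- The transformed Riordan array and its A-sequence.

module Riordan {c ℓ : Level} (K : Field c ℓ) where
  open FPS K using (riordan; dtilde; IsCompInverse; IsASeqGF)
  open Composition K
  open Lagrange K

  -- Here `q` is p - 1, and `ψ-eq` expresses ψ = t^p / f^(p-1) with the denominator cleared.
  module _ (f : Series) (f₀ : f 0 ≈ 0#) (q : ℕ)
           (ψ : Series) (ψ-eq : ψ ⊛ f ^ˢ q ≋ X ^ˢ suc q)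
           (φ : Series) (φ-inverse : IsCompInverse φ ψ) where

    φ₀ : φ 0 ≈ 0#
    φ₀ = φ-inverse .proj₁

    ψ∘φ : ψ ∘ˢ φ ≋ X
    ψ∘φ = φ-inverse .proj₂ .proj₁

    u U : Series
    u = tail f
    U = u ^ˢ q

    f^ : ∀ k → f ^ˢ k ≋ X ^ˢ k ⊛ u ^ˢ k
    f^ k = trans (^-cong k (X-tail f f₀)) (^-⊛ X u k)

    ψ⊛U : ψ ⊛ U ≋ X
    ψ⊛U = X^-cancel q (ψ ⊛ U) X (begin
      X ^ˢ q ⊛ (ψ ⊛ U)  ≈⟨ solve 3 (λ x p v → x :* (p :* v) := p :* (x :* v)) refl (X ^ˢ q) ψ U ⟩
      ψ ⊛ (X ^ˢ q ⊛ U)  ≈⟨ *-congˡ (f^ q) ⟨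
      ψ ⊛ f ^ˢ q        ≈⟨ ψ-eq ⟩
      X ⊛ X ^ˢ q        ≈⟨ *-comm X (X ^ˢ q) ⟩
      X ^ˢ q ⊛ X        ∎)

    -- Composing ψ U = t with `φ` turns the inverse relation into the implicit equation that
    -- Lagrange inversion starts from.
    φ-eq : φ ≋ X ⊛ (U ∘ˢ φ)
    φ-eq = begin
      φ                      ≈⟨ X-∘ φ φ₀ ⟨
      X ∘ˢ φ                 ≈⟨ ∘-cong φ φ₀ ψ⊛U ⟨
      (ψ ⊛ U) ∘ˢ φ           ≈⟨ ∘-⊛ φ φ₀ ψ U ⟩
      (ψ ∘ˢ φ) ⊛ (U ∘ˢ φ)    ≈⟨ *-congʳ {U ∘ˢ φ} ψ∘φ ⟩
      X ⊛ (U ∘ˢ φ)           ∎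

    ψ₀ : ψ 0 ≈ 0#
    -- `(ψ ∘ˢ φ) 0` unfolds to `ψ 0` times `1#`.
    ψ₀ = K.trans (K.sym (K.*-identityʳ _)) (ψ∘φ 0)

    tail-ψ⊛U : tail ψ ⊛ U ≋ one
    tail-ψ⊛U = X-cancel (tail ψ ⊛ U) one (begin
      X ⊛ (tail ψ ⊛ U)    ≈⟨ *-assoc X (tail ψ) U ⟨
      (X ⊛ tail ψ) ⊛ U    ≈⟨ *-congʳ {U} (X-tail ψ ψ₀) ⟨
      ψ ⊛ U               ≈⟨ ψ⊛U ⟩
      X                   ≈⟨ *-identityʳ X ⟨
      X ⊛ one             ∎)

    -- Since `tail ψ` is ψ/t, the reciprocal of `U`, this series is 1/U(φ) = s/φ: the multiplier
    -- that turns `φ` into `X`.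
    ξ : Series
    ξ = tail ψ ∘ˢ φ

    ξ⊛φ : ξ ⊛ φ ≋ X
    ξ⊛φ = begin
      ξ ⊛ φ                   ≈⟨ *-congˡ φ-eq ⟩
      ξ ⊛ (X ⊛ (U ∘ˢ φ))      ≈⟨ solve 3 (λ y x v → y :* (x :* v) := x :* (y :* v)) refl ξ X (U ∘ˢ φ) ⟩
      X ⊛ (ξ ⊛ (U ∘ˢ φ))      ≈⟨ *-congˡ (∘-⊛ φ φ₀ (tail ψ) U) ⟨
      X ⊛ ((tail ψ ⊛ U) ∘ˢ φ) ≈⟨ *-congˡ (trans (∘-cong φ φ₀ tail-ψ⊛U) (∘-one φ φ₀)) ⟩
      X ⊛ one                 ≈⟨ *-identityʳ X ⟩
      X                       ∎

    -- Multiplying by `ξ ^ˢ m` turns `φ ^ˢ m` into `X ^ˢ m`, which cancels by a shift of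
    -- coefficients.
    φ^-cancel : ∀ m a b → φ ^ˢ m ⊛ a ≋ φ ^ˢ m ⊛ b → a ≋ b
    φ^-cancel m a b e = X^-cancel m a b (begin
      X ^ˢ m ⊛ a               ≈⟨ expand a ⟩
      ξ ^ˢ m ⊛ (φ ^ˢ m ⊛ a)    ≈⟨ *-congˡ e ⟩
      ξ ^ˢ m ⊛ (φ ^ˢ m ⊛ b)    ≈⟨ expand b ⟨
      X ^ˢ m ⊛ b               ∎)
      where
      expand : ∀ a → X ^ˢ m ⊛ a ≋ ξ ^ˢ m ⊛ (φ ^ˢ m ⊛ a)
      expand a = trans (*-congʳ {a} (trans (^-cong m (sym ξ⊛φ)) (^-⊛ ξ φ m)))
        (*-assoc (ξ ^ˢ m) (φ ^ˢ m) a)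

    F : Series
    F = f ∘ˢ φ

    F-eq : F ≋ φ ⊛ (u ∘ˢ φ)
    F-eq = trans (∘-cong φ φ₀ (X-tail f f₀)) (∘-X-⊛ φ φ₀ u)

    λ₁ : Series
    λ₁ = λ₀ U φ φ₀ φ-eq

    -- Substituting φ′ = U(φ) `λ₁` and F = φ u(φ) into the equation for `G` exposes s U(φ) φ^r =
    -- φ^(r+1), which is then cancelled.
    first-component : ∀ g r G → G ⊛ φ ^ˢ (r + 1) ≋ X ⊛ deriv φ ⊛ (g ∘ˢ φ) ⊛ F ^ˢ r →
                      G ≋ (g ∘ˢ φ) ⊛ (u ∘ˢ φ) ^ˢ r ⊛ λ₁
    first-component g r G G-eq = φ^-cancel (r + 1) G W (begin
      φ ^ˢ (r + 1) ⊛ G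
        ≈⟨ *-comm (φ ^ˢ (r + 1)) G ⟩
      G ⊛ φ ^ˢ (r + 1)
        ≈⟨ G-eq ⟩
      X ⊛ deriv φ ⊛ (g ∘ˢ φ) ⊛ F ^ˢ r
        ≈⟨ *-cong (*-congʳ {g ∘ˢ φ} (*-congˡ (deriv-φ U φ φ₀ φ-eq)))
                  (trans (^-cong r F-eq) (^-⊛ φ (u ∘ˢ φ) r)) ⟩
      X ⊛ ((U ∘ˢ φ) ⊛ λ₁) ⊛ (g ∘ˢ φ) ⊛ (φ ^ˢ r ⊛ (u ∘ˢ φ) ^ˢ r)
        -- The `con 1` is the trailing `one` in `φ ^ˢ 1`, which unfolds to `φ ⊛ one`.
        ≈⟨ solve 6 (λ x v l g p w → ((x :* (v :* l)) :* g) :* (p :* w)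
                                 := (p :* ((x :* v) :* con 1)) :* ((g :* w) :* l)) refl
             X (U ∘ˢ φ) λ₁ (g ∘ˢ φ) (φ ^ˢ r) ((u ∘ˢ φ) ^ˢ r) ⟩
      (φ ^ˢ r ⊛ ((X ⊛ (U ∘ˢ φ)) ⊛ one)) ⊛ W
        ≈⟨ *-congʳ {W} (trans (^-+ φ r 1) (*-congˡ (*-congʳ {one} φ-eq))) ⟨
      φ ^ˢ (r + 1) ⊛ W ∎)
      where
      W : Series
      W = (g ∘ˢ φ) ⊛ (u ∘ˢ φ) ^ˢ r ⊛ λ₁

    -- With m = qn + r, the entry lies in row m + n and column m + k. In f^(m+k) = t^m u^m f^k the
    -- factor t^m lowers the degree to n, and u^m = Uⁿ u^r supplies the power that `Λ` requires.
    dtilde-Λ : ∀ g r n k → dtilde (riordan g f) (suc q) r n k ≈ Λ U φ φ₀ φ-eq 0 (g ⊛ u ^ˢ r ⊛ f ^ˢ k) n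
    dtilde-Λ g r n k = K.begin
      (g ⊛ f ^ˢ (m + k)) (n + q * n + r)                    K.≡⟨ ≡.cong (g ⊛ f ^ˢ (m + k)) index ⟩
      (g ⊛ f ^ˢ (m + k)) (m + n)                            K.≈⟨ factor (m + n) ⟩
      (X ^ˢ m ⊛ (g ⊛ u ^ˢ r ⊛ f ^ˢ k ⊛ U ^ˢ n)) (m + n)     K.≈⟨ X^-⊛-+ m (g ⊛ u ^ˢ r ⊛ f ^ˢ k ⊛ U ^ˢ n) n ⟩
      (g ⊛ u ^ˢ r ⊛ f ^ˢ k ⊛ U ^ˢ n) n                      K.∎
      where
      m : ℕ
      m = q * n + r
      index : n + q * n + r ≡ m + n
      index = ≡.trans (ℕₚ.+-assoc n (q * n) r) (ℕₚ.+-comm n m)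
      factor : g ⊛ f ^ˢ (m + k) ≋ X ^ˢ m ⊛ (g ⊛ u ^ˢ r ⊛ f ^ˢ k ⊛ U ^ˢ n)
      factor = begin
        g ⊛ f ^ˢ (m + k)
          ≈⟨ *-congˡ (^-+ f m k) ⟩
        g ⊛ (f ^ˢ m ⊛ f ^ˢ k)
          ≈⟨ *-congˡ (*-congʳ {f ^ˢ k} (f^ m)) ⟩
        g ⊛ ((X ^ˢ m ⊛ u ^ˢ m) ⊛ f ^ˢ k)
          ≈⟨ *-congˡ (*-congʳ {f ^ˢ k} (*-congˡ (trans (^-+ u (q * n) r) (*-congʳ {u ^ˢ r} (^-* u q n))))) ⟩
        g ⊛ ((X ^ˢ m ⊛ (U ^ˢ n ⊛ u ^ˢ r)) ⊛ f ^ˢ k)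
          ≈⟨ solve 5 (λ g x v w y → g :* ((x :* (v :* w)) :* y) := x :* (((g :* w) :* y) :* v)) refl
               g (X ^ˢ m) (U ^ˢ n) (u ^ˢ r) (f ^ˢ k) ⟩
        X ^ˢ m ⊛ (g ⊛ u ^ˢ r ⊛ f ^ˢ k ⊛ U ^ˢ n) ∎

    -- `Λ-zero` evaluates column `k`; composition with `φ` is multiplicative, so `F ^ˢ k` splits off
    -- and the remaining factor is `G` by `first-component`.
    dtilde-riordan : ∀ g r G → G ⊛ φ ^ˢ (r + 1) ≋ X ⊛ deriv φ ⊛ (g ∘ˢ φ) ⊛ F ^ˢ r →
                     ∀ n k → dtilde (riordan g f) (suc q) r n k ≈ riordan G F n k
    dtilde-riordan g r G G-eq n k = K.trans (dtilde-Λ g r n k) (Λ-value n)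
      where
      Λ-value : Λ U φ φ₀ φ-eq 0 (g ⊛ u ^ˢ r ⊛ f ^ˢ k) ≋ G ⊛ F ^ˢ k
      Λ-value = begin
        Λ U φ φ₀ φ-eq 0 (g ⊛ u ^ˢ r ⊛ f ^ˢ k)
          ≈⟨ Λ-zero U φ φ₀ φ-eq (g ⊛ u ^ˢ r ⊛ f ^ˢ k) ⟩
        ((g ⊛ u ^ˢ r ⊛ f ^ˢ k) ∘ˢ φ) ⊛ λ₁
          ≈⟨ *-congʳ {λ₁} (begin
               (g ⊛ u ^ˢ r ⊛ f ^ˢ k) ∘ˢ φ
                 ≈⟨ ∘-⊛ φ φ₀ (g ⊛ u ^ˢ r) (f ^ˢ k) ⟩
               ((g ⊛ u ^ˢ r) ∘ˢ φ) ⊛ ((f ^ˢ k) ∘ˢ φ)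
                 ≈⟨ *-cong (∘-⊛ φ φ₀ g (u ^ˢ r)) (∘-^ φ φ₀ f k) ⟩
               (g ∘ˢ φ) ⊛ ((u ^ˢ r) ∘ˢ φ) ⊛ F ^ˢ k
                 ≈⟨ *-congʳ {F ^ˢ k} (*-congˡ (∘-^ φ φ₀ u r)) ⟩
               (g ∘ˢ φ) ⊛ (u ∘ˢ φ) ^ˢ r ⊛ F ^ˢ k ∎) ⟩
        (g ∘ˢ φ) ⊛ (u ∘ˢ φ) ^ˢ r ⊛ F ^ˢ k ⊛ λ₁
          ≈⟨ solve 3 (λ x y l → (x :* y) :* l := (x :* l) :* y) refl
               ((g ∘ˢ φ) ⊛ (u ∘ˢ φ) ^ˢ r) (F ^ˢ k) λ₁ ⟩
        (g ∘ˢ φ) ⊛ (u ∘ˢ φ) ^ˢ r ⊛ λ₁ ⊛ F ^ˢ k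
          ≈⟨ *-congʳ {F ^ˢ k} (first-component g r G G-eq) ⟨
        G ⊛ F ^ˢ k ∎

    -- Cancelling t in f = t A(f) gives u = A(f), hence u(φ) = A(F). One factor u(φ) comes from F =
    -- φ u(φ) and the other `q` from φ = s U(φ), so F = s A(F)^p.
    A-sequence : ∀ A → IsASeqGF A f → IsASeqGF (A ^ˢ suc q) F
    A-sequence A A-eq = begin
      F                                           ≈⟨ F-eq ⟩
      φ ⊛ (u ∘ˢ φ)                                ≈⟨ *-congʳ {u ∘ˢ φ} φ-eq ⟩
      (X ⊛ (U ∘ˢ φ)) ⊛ (u ∘ˢ φ)                   ≈⟨ *-assoc X (U ∘ˢ φ) (u ∘ˢ φ) ⟩
      X ⊛ ((U ∘ˢ φ) ⊛ (u ∘ˢ φ))                   ≈⟨ *-congˡ (*-comm (U ∘ˢ φ) (u ∘ˢ φ)) ⟩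
      X ⊛ ((u ∘ˢ φ) ⊛ (U ∘ˢ φ))                   ≈⟨ *-congˡ (*-congˡ (∘-^ φ φ₀ u q)) ⟩
      X ⊛ ((u ∘ˢ φ) ^ˢ suc q)                     ≈⟨ *-congˡ (^-cong (suc q) u∘φ) ⟩
      X ⊛ ((A ∘ˢ F) ^ˢ suc q)                     ≈⟨ *-congˡ (∘-^ F (∘-zero φ φ₀ f f₀) A (suc q)) ⟨
      X ⊛ ((A ^ˢ suc q) ∘ˢ F)                     ∎
      where
      u-eq : u ≋ A ∘ˢ f
      u-eq = X-cancel u (A ∘ˢ f) (trans (sym (X-tail f f₀)) A-eq)
      u∘φ : u ∘ˢ φ ≋ A ∘ˢ F
      u∘φ = trans (∘-cong φ φ₀ u-eq) (∘-assoc A f φ f₀ φ₀)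

theorem2p2 : ∀ {c ℓ : Level} (K : Field c ℓ) →
    let open FPS K
    in (g f : Series) → g 0 ≈ 1# → f 0 ≈ 0# → ¬ (f 1 ≈ 0#) →
    let d = riordan g f
    in ((p r : ℕ) → 1 ≤ p →
    (ψ : Series) → ψ ⊛ (f ^ˢ (p ∸ 1)) ≋ X ^ˢ p →
    (φ : Series) → IsCompInverse φ ψ →
    (G : Series) →
    G ⊛ (φ ^ˢ (r + 1)) ≋ X ⊛ deriv φ ⊛ (g ∘ˢ φ) ⊛ ((f ∘ˢ φ) ^ˢ r) →
    ((n k : ℕ) → dtilde d p r n k ≈ riordan G (f ∘ˢ φ) n k)
    × ((A : Series) → IsASeqGF A f → IsASeqGF (A ^ˢ p) (f ∘ˢ φ)))
    × ((n k : ℕ) → dtilde d 1 0 n k ≈ d n k)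
    × ((n k : ℕ) → dtilde d 2 0 n k ≈ d (2 * n) (n + k))
theorem2p2 K g f g₀ f₀ f₁ =
    -- The bound `1 ≤ p` rules out zero, and for `suc q` the exponent `p ∸ 1` reduces to `q`.
    (λ { (suc q) r _ ψ ψ-eq φ φ-inverse G G-eq →
         dtilde-riordan f f₀ q ψ ψ-eq φ φ-inverse g r G G-eq
       , A-sequence f f₀ q ψ ψ-eq φ φ-inverse })
  -- The column index already reduces to `k`; only the row index `n + 0 + 0` needs rewriting.
  , (λ n k → reflexive (≡.cong (λ i → riordan g f i k)
               (≡.trans (ℕₚ.+-identityʳ (n + 0)) (ℕₚ.+-identityʳ n))))
  , (λ n k → reflexive (≡.cong₂ (riordan g f) (ℕₚ.+-identityʳ (2 * n))
               (≡.cong (_+ k) (≡.trans (ℕₚ.+-identityʳ (n + 0)) (ℕₚ.+-identityʳ n)))))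
  where
  open FPS K using (riordan)
  open Field K using (reflexive)
  open Riordan K
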